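{- For every positive integer $k$ there exists $n$ such that the shift graph $H_n$ does not admit two $k$-orthogonal tree decompositions.
   Context: The shift graph $H_n$ has vertex set $\{(i,j):1\le i<j\le n\}$ and edge set $\{(i,j)(j,\ell):1\le i<j<\ell\le n\}$. A tree decomposition of a graph $G$ is a tree with bags $T_x\subseteq V(G)$ such that every edge has both ends in some bag and for every vertex the nodes whose bags contain it induce a non-empty connected subtree. Two tree decompositions $S$ and $T$ of $G$ are $k$-orthogonal if $|S_x\cap T_y|\le k$ for all nodes $x$ of $S$ and $y$ of $T$. -}

module Defs where

open import Data.Nat using (ℕ; suc; _<_)
open import Data.Fin using (Fin; toℕ)
open import Data.Product using (Σ; ∃; _×_; _,_)
open import Data.Sum using (_⊎_)
open import Data.Unit using (⊤)
open import Relation.Nullary using (¬_)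
open import Relation.Binary.PropositionalEquality using (_≡_)
open import Function.Definitions using (Injective)

record Graph : Set₁ where
  field
    V   : Set
    Adj : V → V → Set
open Graph public

data Walk {A : Set} (E : A → A → Set) (P : A → Set) : A → A → Set where
  here : ∀ {x} → P x → Walk E P x x
  step : ∀ {x y z} → P x → E x y → Walk E P y z → Walk E P x z

InducedConnected : {A : Set} → (A → A → Set) → (A → Set) → Set
InducedConnected E P = ∀ x y → P x → P y → Walk E P x y

Total : {A : Set} → A → Set
Total _ = ⊤

Connected : {A : Set} → (A → A → Set) → Set
Connected E = InducedConnected E Total

DeleteEdge : {A : Set} → (A → A → Set) → A → A → (A → A → Set)
DeleteEdge E u v x y = E x y × ¬ ((x ≡ u × y ≡ v) ⊎ (x ≡ v × y ≡ u))

record Tree : Set₁ where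
  field
    m      : ℕ
    nonempty : 0 < m
    E      : Fin m → Fin m → Set
    sym    : ∀ x y → E x y → E y x
    irrefl : ∀ x → ¬ E x x
    connected : Connected E
    minimal : ∀ u v → E u v → ¬ Connected (DeleteEdge E u v)

record TreeDecomposition (G : Graph) : Set₁ where
  field
    tree : Tree
    bag  : Fin (Tree.m tree) → V G → Set
    edgeCovered : ∀ u v → Adj G u v → ∃ λ x → bag x u × bag x v
    vertexNonempty : ∀ v → ∃ λ x → bag x v
    vertexConnected : ∀ v → InducedConnected (Tree.E tree) (λ x → bag x v)
open TreeDecomposition public

AtMost : {A : Set} → ℕ → (A → Set) → Set
AtMost {A} k P = ∀ (f : Fin (suc k) → A) → Injective _≡_ _≡_ f → ¬ (∀ i → P (f i))

Orthogonal : {G : Graph} → ℕ → TreeDecomposition G → TreeDecomposition G → Set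
Orthogonal k S T =
  ∀ (x : Fin (Tree.m (tree S))) (y : Fin (Tree.m (tree T))) →
    AtMost k (λ v → bag S x v × bag T y v)

-- The shift graph H_n: vertices (i,j) with 1 ≤ i < j ≤ n (here 0-based
-- indices in Fin n), edges (i,j)(j,ℓ) with i < j < ℓ (undirected).

ShiftVertex : ℕ → Set
ShiftVertex n = Σ (Fin n) λ i → Σ (Fin n) λ j → toℕ i < toℕ j

fstV : ∀ {n} → ShiftVertex n → Fin n
fstV (i , _ , _) = i

sndV : ∀ {n} → ShiftVertex n → Fin n
sndV (_ , j , _) = j

ShiftAdj : ∀ {n} → ShiftVertex n → ShiftVertex n → Set
ShiftAdj p q = (sndV p ≡ fstV q) ⊎ (sndV q ≡ fstV p)

ShiftGraph : ℕ → Graph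
ShiftGraph n = record { V = ShiftVertex n ; Adj = ShiftAdj }

{-# OPTIONS --safe #-}
-- Root each tree and let the top of a vertex be the shallowest node whose bag contains it.
-- If u and v share a bag and the top of v is at least as deep as that of u, then the top
-- of v contains u; nothing else about trees is used. Two consequences for H_n:
-- (1) At each j, a single bag contains all (i , j) or a single bag contains all (j , l):
-- take the top of the vertex at j whose top is deepest. By orthogonality (and for j away
-- from the ends) S and T take different sides, so, after possibly swapping S and T, there
-- are many j such that T has a bag with all (j , l). Then any bag of S contains at most k
-- of the vertices (j , l), for each such j.
-- (2) This is impossible. Write d for the depth of tops. Among such j choose greedily
-- g < h's < K < m, with |K| = k + 1, such that d(a,b) ≤ d(b,c) for all chosen a < b < c.
-- If d(i,l) < d(h,l) with i < l in K, then the top of (i,l) contains (g,h), so there are at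
-- most k such h for each (i,l). Hence some h has d(h,l) ≤ d(i,l) for all i < l in K. Then
-- the top of (i,l) contains both (h,i) and (h,l); so the vertices (h,i), i ∈ K, pairwise
-- share bags, and the deepest of their tops contains them all.
module Submission where

open import Defs
open import Data.Nat using (ℕ; zero; suc; _+_; _*_; _≤_; _<_; z≤n; s≤s; _<?_)
open import Data.Nat.Properties as ℕ
  using (≤-refl; ≤-trans; ≤-reflexive; <-≤-trans; ≤-<-trans; <⇒≤; ≮⇒≥; ≰⇒>; <⇒≱; ≤-total)
open import Data.Fin as Fin using (Fin; zero; suc; toℕ; fromℕ<; inject≤)
open import Data.Fin.Properties as Fin using (inject≤-injective; sequence)
open import Data.List using (List; []; _∷_; _++_; length; filter; lookup; allFin; cartesianProduct; map)
open import Data.List.Properties using (length-tabulate; length-++; length-map)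
open import Data.List.Extrema.Nat using (argmax; argmax-all; f[xs]≤f[argmax])
open import Data.List.Membership.Propositional using (_∈_)
open import Data.List.Membership.Propositional.Properties
  using (∈-++⁺ˡ; ∈-++⁺ʳ; ∈-++⁻; ∈-filter⁺; ∈-allFin; ∈-lookup; ∈-cartesianProduct⁺; ∈-cartesianProduct⁻)
open import Data.List.Relation.Unary.Any using (here; there)
open import Data.List.Relation.Unary.All as All using (All; []; _∷_)
open import Data.List.Relation.Unary.All.Properties as All using (all-filter)
open import Data.List.Relation.Unary.AllPairs using (AllPairs; []; _∷_)
open import Data.List.Relation.Unary.AllPairs.Properties as AllPairs using ()
open import Data.List.Relation.Binary.Sublist.Propositional
  using (_⊆_; []; _∷_; _∷ʳ_; ⊆-refl; ⊆-trans; minimum)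
open import Data.List.Relation.Binary.Sublist.Propositional.Properties
  using (filter-⊆; Any-resp-⊆; All-resp-⊆)
open import Data.Product using (Σ; ∃; ∃₂; _×_; _,_; proj₁; proj₂; swap)
open import Data.Sum using (_⊎_; inj₁; inj₂)
open import Data.Empty using (⊥; ⊥-elim)
open import Data.Unit using (tt)
open import Effect.Monad using (RawMonad)
open import Function using (_∘_; id)
open import Function.Definitions using (Injective)
open import Relation.Nullary using (¬_; Dec; yes; no; contradiction)
open import Relation.Nullary.Decidable using (¬?; _×-dec_)
open import Relation.Nullary.Negation using (¬¬-Monad)
open import Relation.Binary.Definitions using (tri<; tri≈; tri>)
open import Relation.Binary.PropositionalEquality using (_≡_; _≢_; refl; sym; trans; cong; cong₂; subst)

-- Finite choice and least elements under double negation

-- Bags and tree edges come without decision procedures, so depths and tops are obtained only up to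
-- double negation, which is harmless as the final goal is `⊥`. Finiteness of the index set lets all
-- choices be made at once.
¬¬-∀ : ∀ {n} {P : Fin n → Set} → (∀ i → ¬ ¬ P i) → ¬ ¬ (∀ i → P i)
¬¬-∀ = sequence (RawMonad.rawApplicative ¬¬-Monad)

IsLeast : {A : Set} → (A → ℕ) → (A → Set) → A → Set
IsLeast f P a = P a × (∀ b → P b → f a ≤ f b)

¬¬-least : {A : Set} (f : A → ℕ) (P : A → Set) → ∃ P → ¬ ¬ (∃ (IsLeast f P))
¬¬-least f P (a₀ , pa₀) none = go (suc (f a₀)) a₀ ≤-refl pa₀
  where
  go : ∀ n a → f a < n → P a → ⊥
  go (suc n) a (s≤s fa≤n) pa =
    none (a , pa , λ b pb → ≮⇒≥ λ fb<fa → go n b (<-≤-trans fb<fa fa≤n) pb)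

-- Rooted trees

module _ {A : Set} {E : A → A → Set} {P : A → Set} where

  walk-source : ∀ {x y} → Walk E P x y → P x
  walk-source (here px)     = px
  walk-source (step px _ _) = px

  _++ʷ_ : ∀ {x y z} → Walk E P x y → Walk E P y z → Walk E P x z
  here _       ++ʷ w′ = w′
  step px e w ++ʷ w′ = step px e (w ++ʷ w′)

  walk-reverse : (∀ x y → E x y → E y x) → ∀ {x y} → Walk E P x y → Walk E P y x
  walk-reverse E-sym (here px)     = here px
  walk-reverse E-sym (step px e w) =
    walk-reverse E-sym w ++ʷ step (walk-source w) (E-sym _ _ e) (here px)

-- The parent of the root is a junk value; a genuine parent is one of smaller depth.
record Rooting {m : ℕ} (E : Fin m → Fin m → Set) : Set where
  field
    parent : Fin m → Fin m
    depth  : Fin m → ℕ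
    edge   : ∀ {u v} → E u v →
             (v ≡ parent u × depth v < depth u) ⊎ (u ≡ parent v × depth u < depth v)

¬¬-rooting : (T : Tree) → ¬ ¬ Rooting (Tree.E T)
¬¬-rooting T noRooting = ¬¬-∀ (λ v → ¬¬-least id (Reach v) (reach (connected v root tt tt))) λ least →
  noRooting (build (proj₁ ∘ least) (proj₂ ∘ least))
  where
  open Tree T

  root : Fin m
  root = fromℕ< nonempty

  -- Counts the steps of a walk, so that the least `d` is the distance to the root; this distance
  -- serves as the depth.
  Reach : Fin m → ℕ → Set
  Reach v zero    = v ≡ root
  Reach v (suc d) = ∃ λ p → E v p × Reach p d

  reach : ∀ {v} → Walk E Total v root → ∃ (Reach v)
  reach (here _)     = 0 , refl
  reach (step _ e w) = let d , r = reach w in suc d , _ , e , r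

  build : (depth : Fin m → ℕ) → (∀ v → IsLeast id (Reach v) (depth v)) → Rooting E
  build depth least = record { parent = parent ; depth = depth ; edge = edge }
    where
    up : ∀ v → ∃ λ p → v ≡ root ⊎ (E v p × depth p < depth v)
    up v with depth v | least v
    ... | zero  | v≡root , _      = v , inj₁ v≡root
    ... | suc d | (p , e , r) , _ = p , inj₂ (e , s≤s (proj₂ (least p) d r))

    parent : Fin m → Fin m
    parent = proj₁ ∘ up

    Parent : Fin m → Fin m → Set
    Parent u v = v ≡ parent u × depth v < depth u

    parent? : ∀ u v → Dec (Parent u v)
    parent? u v = (v Fin.≟ parent u) ×-dec (depth v <? depth u)

    module _ {u v} (u↛v : ¬ Parent u v) (v↛u : ¬ Parent v u) where

      -- The parent edges alone lead every node to the root. An edge that joins neither end to its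
      -- parent could therefore be deleted without disconnecting the tree, against minimality.
      to-root : ∀ n w → depth w < n → Walk (DeleteEdge E u v) Total w root
      to-root (suc n) w (s≤s dw≤n) with proj₂ (up w)
      ... | inj₁ refl     = here tt
      ... | inj₂ (e , lt) = step tt (e , kept) (to-root n (parent w) (<-≤-trans lt dw≤n))
        where
        kept : ¬ ((w ≡ u × parent w ≡ v) ⊎ (w ≡ v × parent w ≡ u))
        kept (inj₁ (refl , refl)) = u↛v (refl , lt)
        kept (inj₂ (refl , refl)) = v↛u (refl , lt)

      delete-sym : ∀ x y → DeleteEdge E u v x y → DeleteEdge E u v y x
      delete-sym x y (e , kept) = Tree.sym T x y e , λ
        { (inj₁ (p , q)) → kept (inj₂ (q , p)) ; (inj₂ (p , q)) → kept (inj₁ (q , p)) }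

      delete-connected : Connected (DeleteEdge E u v)
      delete-connected x y _ _ =
        to-root _ x ≤-refl ++ʷ walk-reverse delete-sym (to-root _ y ≤-refl)

    edge : ∀ {u v} → E u v → Parent u v ⊎ Parent v u
    edge {u} {v} e with parent? u v | parent? v u
    ... | yes p | _     = inj₁ p
    ... | no  _ | yes q = inj₂ q
    ... | no ¬p | no ¬q = ⊥-elim (minimal u v e (delete-connected ¬p ¬q))

module _ {m : ℕ} {E : Fin m → Fin m → Set} (R : Rooting E) where
  open Rooting R

  -- The guard in `child` excludes the junk parent of the root and makes depth grow strictly away
  -- from `z`.
  data Descendant (z : Fin m) : Fin m → Set where
    self  : Descendant z z
    child : ∀ {u} → depth (parent u) < depth u → Descendant z (parent u) → Descendant z u

  descendant-deeper : ∀ {z u} → Descendant z u → u ≡ z ⊎ depth z < depth u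
  descendant-deeper self = inj₁ refl
  descendant-deeper {z} (child {u} lt D) with parent u | lt | descendant-deeper D
  ... | _ | lt′ | inj₁ refl = inj₂ lt′
  ... | _ | lt′ | inj₂ lt″  = inj₂ (ℕ.<-trans lt″ lt′)

  -- A walk leaves the descendants of z only through the parent of z.
  leave : ∀ {P : Fin m → Set} {z u y} → Walk E P u y → Descendant z u →
          Descendant z y ⊎ (P (parent z) × depth (parent z) < depth z)
  leave (here _) D = inj₁ D
  leave (step pu e w) D with edge e
  leave (step pu e w) self        | inj₁ (refl , lt) = inj₂ (walk-source w , lt)
  leave (step pu e w) (child _ D) | inj₁ (refl , _)  = leave w D
  leave (step pu e w) D           | inj₂ (refl , lt) = leave w (child lt D)

  -- A node other than `z` and no deeper than `z` is not a descendant of `z`, so the walk to it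
  -- inside `P` has to leave through the parent.
  climb : ∀ {P : Fin m → Set} {z y} → InducedConnected E P → P z → P y →
          depth y ≤ depth z → y ≢ z → P (parent z) × depth (parent z) < depth z
  climb conn pz py y≤z y≢z with leave (conn _ _ pz py) self
  ... | inj₂ up = up
  ... | inj₁ D with descendant-deeper D
  ...   | inj₁ y≡z = contradiction y≡z y≢z
  ...   | inj₂ z<y = contradiction y≤z (<⇒≱ z<y)

  -- Climb from `x` until `t` is met, staying in both subtrees. Below `t`, connectedness of `Q` puts
  -- the parent into `Q`; the parent is thus no shallower than `t`, hence than `s`, so `P` reaches
  -- up to it too.
  top-of-intersection : ∀ {P Q : Fin m → Set} → InducedConnected E P → InducedConnected E Q →
    ∀ {s t x} → IsLeast depth P s → IsLeast depth Q t → depth s ≤ depth t →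
    P x → Q x → P t
  top-of-intersection {P} {Q} connP connQ {s} {t} (ps , _) (qt , least-t) s≤t px qx =
    go _ _ ≤-refl px qx
    where
    go : ∀ n z → depth z < n → P z → Q z → P t
    go (suc n) z (s≤s z≤n′) pz qz with t Fin.≟ z
    ... | yes refl = pz
    ... | no t≢z =
      let qp , lt = climb connQ qz qt (least-t z qz) t≢z
          s<z     = ≤-<-trans (≤-trans s≤t (least-t _ qp)) lt
          pp , _  = climb connP pz ps (<⇒≤ s<z) (λ { refl → ℕ.<-irrefl refl s<z })
      in go n (parent z) (<-≤-trans lt z≤n′) pp qp

-- Tops of the vertices of the shift graph

Holds : ∀ {n} (T : TreeDecomposition (ShiftGraph n)) → Fin (Tree.m (tree T)) → Fin n → Fin n → Set
Holds T x i j = Σ (i Fin.< j) λ i<j → bag T x (i , j , i<j)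

-- top and depth are junk at pairs that are not increasing.
record Tops {n : ℕ} {X : Set} (B : X → Fin n → Fin n → Set) : Set where
  field
    top       : Fin n → Fin n → X
    depth     : Fin n → Fin n → ℕ
    top-holds : ∀ {x a b c e} → B x a b → B x c e → depth a b ≤ depth c e → B (top c e) a b
    adjacent  : ∀ {a b c} → a Fin.< b → b Fin.< c → ∃ λ x → B x a b × B x b c

¬¬-tops : ∀ {n} (T : TreeDecomposition (ShiftGraph n)) → ¬ ¬ Tops (Holds T)
¬¬-tops {n} T noTops = ¬¬-rooting (tree T) λ R → ¬¬-∀ (λ i → ¬¬-∀ (λ j → least R i j)) λ tops →
  noTops (build R (λ i j → proj₁ (tops i j)) (λ i j → proj₂ (tops i j)))
  where
  TopAt : Rooting (Tree.E (tree T)) → Fin n → Fin n → Fin (Tree.m (tree T)) → Set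
  TopAt R i j x = ∀ i<j → IsLeast (Rooting.depth R) (λ y → bag T y (i , j , i<j)) x

  least : ∀ R i j → ¬ ¬ ∃ (TopAt R i j)
  least R i j none with i Fin.<? j
  -- `TopAt` is vacuous here, so any node serves.
  ... | no i≮j  = none (fromℕ< (Tree.nonempty (tree T)) , λ i<j → contradiction i<j i≮j)
  ... | yes i<j = ¬¬-least (Rooting.depth R) _ (vertexNonempty T (i , j , i<j)) λ (x , l) →
    none (x , λ i<j′ → subst (λ p → IsLeast _ (λ y → bag T y (i , j , p)) x) (Fin.<-irrelevant i<j i<j′) l)

  build : ∀ R (top : Fin n → Fin n → Fin (Tree.m (tree T))) →
          (∀ i j → TopAt R i j (top i j)) → Tops (Holds T)
  build R top isTop = record
    { top       = top
    ; depth     = λ i j → Rooting.depth R (top i j)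
    ; top-holds = λ {_} {a} {b} {c} {e} (p , u) (q , v) le →
        p , top-of-intersection R (vertexConnected T _) (vertexConnected T _)
              (isTop a b p) (isTop c e q) le u v
    ; adjacent  = λ p q → let x , u , v = edgeCovered T _ _ (inj₁ refl) in x , (p , u) , (q , v)
    }

-- Lists

Sorted : ∀ {n} → List (Fin n) → Set
Sorted = AllPairs Fin._<_

sorted-lookup-injective : ∀ {n} {xs : List (Fin n)} → Sorted xs → Injective _≡_ _≡_ (lookup xs)
sorted-lookup-injective {xs = _ ∷ _}  _        {zero}  {zero}  _  = refl
sorted-lookup-injective {xs = _ ∷ _}  (px ∷ _) {zero}  {suc j} eq =
  contradiction (All.lookup px (∈-lookup j)) (ℕ.<-irrefl (cong toℕ eq))
sorted-lookup-injective {xs = _ ∷ _}  (px ∷ _) {suc i} {zero}  eq =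
  contradiction (All.lookup px (∈-lookup i)) (ℕ.<-irrefl (cong toℕ (sym eq)))
sorted-lookup-injective {xs = _ ∷ _}  (_ ∷ s)  {suc i} {suc j} eq =
  cong suc (sorted-lookup-injective s eq)

AllPairs-++⁻ : ∀ {A : Set} {R : A → A → Set} xs {ys} → AllPairs R (xs ++ ys) →
               AllPairs R xs × AllPairs R ys × All (λ x → All (R x) ys) xs
AllPairs-++⁻ []       s        = [] , s , []
AllPairs-++⁻ (x ∷ xs) (px ∷ s) =
  let s₁ , s₂ , s₁₂ = AllPairs-++⁻ xs s
  in All.++⁻ˡ xs px ∷ s₁ , s₂ , All.++⁻ʳ xs px ∷ s₁₂

AllPairs-resp-⊆ : ∀ {A : Set} {R : A → A → Set} {xs ys} → xs ⊆ ys → AllPairs R ys → AllPairs R xs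
AllPairs-resp-⊆ []         []       = []
AllPairs-resp-⊆ (_ ∷ʳ s)   (_ ∷ ps) = AllPairs-resp-⊆ s ps
AllPairs-resp-⊆ (refl ∷ s) (p ∷ ps) = All-resp-⊆ s p ∷ AllPairs-resp-⊆ s ps

split : ∀ {A : Set} p {q} (xs : List A) → length xs ≡ p + q →
        ∃₂ λ ys zs → xs ≡ ys ++ zs × length ys ≡ p × length zs ≡ q
split zero    xs       eq = [] , xs , refl , refl , eq
split (suc p) (x ∷ xs) eq =
  let ys , zs , e , ey , ez = split p xs (ℕ.suc-injective eq)
  in x ∷ ys , zs , cong (x ∷_) e , cong suc ey , ez

unmerge : ∀ {A : Set} {P Q : A → Set} (xs : List A) → (∀ {x} → x ∈ xs → P x ⊎ Q x) →
          ∃₂ λ ys zs → ys ⊆ xs × zs ⊆ xs × All P ys × All Q zs × length xs ≡ length ys + length zs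
unmerge []       _  = [] , [] , [] , [] , [] , [] , refl
unmerge (x ∷ xs) pq with unmerge xs (pq ∘ there) | pq (here refl)
... | ys , zs , s , t , ps , qs , eq | inj₁ p =
  x ∷ ys , zs , refl ∷ s , x ∷ʳ t , p ∷ ps , qs , cong suc eq
... | ys , zs , s , t , ps , qs , eq | inj₂ q =
  ys , x ∷ zs , x ∷ʳ s , refl ∷ t , ps , q ∷ qs , trans (cong suc eq) (sym (ℕ.+-suc (length ys) _))

length-filter-split : ∀ {A : Set} {P : A → Set} (P? : ∀ x → Dec (P x)) xs →
  length xs ≡ length (filter P? xs) + length (filter (¬? ∘ P?) xs)
length-filter-split P? []       = refl
length-filter-split P? (x ∷ xs) with P? x
... | yes _ = cong suc (length-filter-split P? xs)
... | no  _ = trans (cong suc (length-filter-split P? xs)) (sym (ℕ.+-suc (length (filter P? xs)) _))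

-- Each `a` in turn discards its bad elements, at most `k` of them, so the total loss is at most
-- `k * length as`.
prune : ∀ {A C : Set} {Bad : A → C → Set} → (∀ a c → Dec (Bad a c)) → ∀ k as (cs : List C) →
  (∀ {a ds} → a ∈ as → ds ⊆ cs → All (Bad a) ds → length ds ≤ k) →
  ∃ λ ds → ds ⊆ cs × length cs ≤ k * length as + length ds ×
           (∀ {a c} → a ∈ as → c ∈ ds → ¬ Bad a c)
prune bad? k []       cs few =
  cs , ⊆-refl , ≤-reflexive (cong (_+ length cs) (sym (ℕ.*-zeroʳ k))) , λ ()
prune {Bad = Bad} bad? k (a ∷ as) cs few =
  let good           = filter (¬? ∘ bad? a) cs
      good⊆          = filter-⊆ (¬? ∘ bad? a) cs
      ds , s , le , ok = prune bad? k as good (λ a∈ s′ → few (there a∈) (⊆-trans s′ good⊆))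
      open ℕ.≤-Reasoning
  in ds , ⊆-trans s good⊆
   , (begin
        length cs                                       ≡⟨ length-filter-split (bad? a) cs ⟩
        length (filter (bad? a) cs) + length good       ≤⟨ ℕ.+-mono-≤ (few (here refl) (filter-⊆ (bad? a) cs) (all-filter (bad? a) cs)) le ⟩
        k + (k * length as + length ds)                 ≡⟨ ℕ.+-assoc k _ _ ⟨
        k + k * length as + length ds                   ≡⟨ cong (_+ length ds) (ℕ.*-suc k (length as)) ⟨
        k * suc (length as) + length ds                 ∎)
   , λ { (here refl) c∈ → All.lookup (All-resp-⊆ s (all-filter (¬? ∘ bad? a) cs)) c∈
       ; (there a∈)  c∈ → ok a∈ c∈ }

-- A bag containing many of the vertices (a , c) for some a

-- The second argument counts the indices still to be chosen, `r` those already chosen. The next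
-- choice uses up itself and at most `k` conflicting indices for each of the `r` earlier ones.
poolSize : ℕ → ℕ → ℕ → ℕ
poolSize k zero    r = 0
poolSize k (suc M) r = suc (k * r + poolSize k M (suc r))

-- One more than the loss when each of the (k + 1)² pairs from `ks` discards `k` indices; then the
-- room for g, the h's, the k + 1 indices of `ks`, and m.
lowerSize coreSize : ℕ → ℕ
lowerSize k = suc (k * (suc k * suc k))
coreSize  k = suc (lowerSize k + (suc k + 1))

length-cartesianProduct : ∀ {A B : Set} (xs : List A) (ys : List B) →
                          length (cartesianProduct xs ys) ≡ length xs * length ys
length-cartesianProduct []       ys = refl
length-cartesianProduct (x ∷ xs) ys = trans (length-++ (map (x ,_) ys))
  (cong₂ _+_ (length-map (x ,_) ys) (length-cartesianProduct xs ys))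

nonempty-∈ : ∀ {A : Set} {xs : List A} → 0 < length xs → ∃ (_∈ xs)
nonempty-∈ {xs = x ∷ _} _ = x , here refl

module _ {n : ℕ} {X : Set} {B : X → Fin n → Fin n → Set} (L : Tops B) (k : ℕ) where
  open Tops L

  Few : Fin n → Set
  Few a = ∀ x cs → Sorted cs → All (B x a) cs → length cs ≤ k

  Monotone : Fin n → Fin n → Fin n → Set
  Monotone a b c = a Fin.< b → b Fin.< c → depth a b ≤ depth b c

  -- Each pair a < b is in conflict with at most k indices c, as the top of (a , b) contains (b , c).
  select : ∀ M as cs → Sorted cs → All Few cs → All (λ a → All (a Fin.<_) cs) as →
    poolSize k M (length as) ≤ length cs →
    ∃ λ bs → bs ⊆ cs × length bs ≡ M ×
      (∀ {a b c} → a ∈ as ++ bs → b ∈ bs → c ∈ bs → Monotone a b c)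
  select zero as cs _ _ _ _ = [] , minimum cs , refl , λ _ ()
  select (suc M) as (b ∷ cs) (b< ∷ sorted) (few-b ∷ few) below (s≤s enough) =
    let ds , ds⊆ , le , ok = prune bad? k as cs few-bad
        below′ = All.map (All-resp-⊆ ds⊆ ∘ All.tail) below
        bs , bs⊆ , eq , mono = select M (b ∷ as) ds (AllPairs-resp-⊆ ds⊆ sorted) (All-resp-⊆ ds⊆ few)
          (All-resp-⊆ ds⊆ b< ∷ below′) (ℕ.+-cancelˡ-≤ (k * length as) _ _ (≤-trans enough le))
    in b ∷ bs , refl ∷ ⊆-trans bs⊆ ds⊆ , cong suc eq
     , mono′ bs (All-resp-⊆ (⊆-trans bs⊆ ds⊆) b<) (λ a∈ c∈ → ok a∈ (Any-resp-⊆ bs⊆ c∈)) mono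
    where
    Bad : Fin n → Fin n → Set
    Bad a c = depth b c < depth a b

    bad? : ∀ a c → Dec (Bad a c)
    bad? a c = depth b c <? depth a b

    few-bad : ∀ {a ds} → a ∈ as → ds ⊆ cs → All (Bad a) ds → length ds ≤ k
    few-bad {a} {ds} a∈ ds⊆ bad = few-b (top a b) ds (AllPairs-resp-⊆ ds⊆ sorted)
      (All.zipWith (λ (b<c , lt) → let _ , ab , bc = adjacent (All.lookup (All.lookup below a∈) (here refl)) b<c
                                   in top-holds bc ab (<⇒≤ lt))
                   (All-resp-⊆ ds⊆ b< , bad))

    mono′ : ∀ bs → All (b Fin.<_) bs → (∀ {a c} → a ∈ as → c ∈ bs → ¬ Bad a c) →
      (∀ {x y z} → x ∈ b ∷ as ++ bs → y ∈ bs → z ∈ bs → Monotone x y z) →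
      ∀ {x y z} → x ∈ as ++ b ∷ bs → y ∈ b ∷ bs → z ∈ b ∷ bs → Monotone x y z
    mono′ bs b<bs ok mono x∈ (here refl) (here refl) x<y y<z = contradiction y<z (ℕ.<-irrefl refl)
    mono′ bs b<bs ok mono x∈ (there y∈)  (here refl) x<y y<z = contradiction y<z (ℕ.<-asym (All.lookup b<bs y∈))
    -- With `b` in the middle, an earlier choice `x` is handled by the pruning, and any other `x`
    -- contradicts the order.
    mono′ bs b<bs ok mono x∈ (here refl) (there z∈)  x<y y<z with ∈-++⁻ as x∈
    ... | inj₁ x∈as         = ≮⇒≥ (ok x∈as z∈)
    ... | inj₂ (here refl)  = contradiction x<y (ℕ.<-irrefl refl)
    ... | inj₂ (there x∈bs) = contradiction x<y (ℕ.<-asym (All.lookup b<bs x∈bs))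
    mono′ bs b<bs ok mono x∈ (there y∈)  (there z∈)  x<y y<z with ∈-++⁻ as x∈
    ... | inj₁ x∈as         = mono (there (∈-++⁺ˡ x∈as)) y∈ z∈ x<y y<z
    ... | inj₂ (here refl)  = mono (here refl) y∈ z∈ x<y y<z
    ... | inj₂ (there x∈bs) = mono (there (∈-++⁺ʳ as x∈bs)) y∈ z∈ x<y y<z

  no-monotone-core : ∀ g hs ks m → Sorted (g ∷ hs ++ ks ++ m ∷ []) → Few g → All Few hs →
    (∀ {a b c} → a ∈ g ∷ hs ++ ks ++ m ∷ [] → b ∈ g ∷ hs ++ ks ++ m ∷ [] →
       c ∈ g ∷ hs ++ ks ++ m ∷ [] → Monotone a b c) →
    k < length ks → k * (length ks * length ks) < length hs → ⊥
  no-monotone-core g hs ks m (g< ∷ sorted) few-g few-hs mono k<ks many-hs =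
    let ds , ds⊆ , le , ok = prune bad? k pairs hs few-bad
        h , h∈ds = nonempty-∈ {xs = ds} (ℕ.+-cancelˡ-< (k * length pairs) _ _ (begin-strict
          k * length pairs + 0           ≡⟨ ℕ.+-identityʳ _ ⟩
          k * length pairs               ≡⟨ cong (k *_) (length-cartesianProduct ks ks) ⟩
          k * (length ks * length ks)    <⟨ many-hs ⟩
          length hs                      ≤⟨ le ⟩
          k * length pairs + length ds   ∎))
    in no-good (Any-resp-⊆ ds⊆ h∈ds) (λ i∈ l∈ → ok (∈-cartesianProduct⁺ i∈ l∈) h∈ds)
    where
    open ℕ.≤-Reasoning

    hs-sorted : Sorted hs
    hs-sorted = proj₁ (AllPairs-++⁻ hs sorted)

    km-split : Sorted ks × Sorted (m ∷ []) × All (λ i → All (i Fin.<_) (m ∷ [])) ks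
    km-split = AllPairs-++⁻ ks (proj₁ (proj₂ (AllPairs-++⁻ hs sorted)))

    h∈ : ∀ {h} → h ∈ hs → h ∈ g ∷ hs ++ ks ++ m ∷ []
    h∈ = there ∘ ∈-++⁺ˡ

    k∈ : ∀ {i} → i ∈ ks → i ∈ g ∷ hs ++ ks ++ m ∷ []
    k∈ = there ∘ ∈-++⁺ʳ hs ∘ ∈-++⁺ˡ

    m∈ : m ∈ g ∷ hs ++ ks ++ m ∷ []
    m∈ = there (∈-++⁺ʳ hs (∈-++⁺ʳ ks (here refl)))

    g<h : ∀ {h} → h ∈ hs → g Fin.< h
    g<h h∈hs = All.lookup g< (∈-++⁺ˡ h∈hs)

    h<k : ∀ {h i} → h ∈ hs → i ∈ ks → h Fin.< i
    h<k h∈hs i∈ks =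
      All.lookup (All.lookup (proj₂ (proj₂ (AllPairs-++⁻ hs sorted))) h∈hs) (∈-++⁺ˡ i∈ks)

    k<m : ∀ {i} → i ∈ ks → i Fin.< m
    k<m i∈ks = All.lookup (All.lookup (proj₂ (proj₂ km-split)) i∈ks) (here refl)

    top-chain : ∀ {a b c} → a ∈ g ∷ hs ++ ks ++ m ∷ [] → b ∈ g ∷ hs ++ ks ++ m ∷ [] →
      c ∈ g ∷ hs ++ ks ++ m ∷ [] → a Fin.< b → b Fin.< c → B (top b c) a b
    top-chain a∈ b∈ c∈ a<b b<c =
      let _ , ab , bc = adjacent a<b b<c in top-holds ab bc (mono a∈ b∈ c∈ a<b b<c)

    pairs : List (Fin n × Fin n)
    pairs = cartesianProduct ks ks

    Bad : Fin n × Fin n → Fin n → Set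
    Bad (i , l) h = i Fin.< l × depth i l < depth h l

    bad? : ∀ p h → Dec (Bad p h)
    bad? (i , l) h = (i Fin.<? l) ×-dec (depth i l <? depth h l)

    -- (i , l) and (h , l) share the top of (l , m), so the top of (h , l), the deeper one, contains
    -- (i , l). It also contains (g , h) by monotonicity. As d(g,h) ≤ d(h,i) ≤ d(i,l), the top of (i
    -- , l) contains (g , h) as well.
    bad-holds : ∀ {i l h} → i ∈ ks → l ∈ ks → h ∈ hs → Bad (i , l) h → B (top i l) g h
    bad-holds i∈ l∈ h∈hs (i<l , lt) =
      top-holds (top-chain (here refl) (h∈ h∈hs) (k∈ l∈) (g<h h∈hs) (h<k h∈hs l∈))
        (top-holds (top-chain (k∈ i∈) (k∈ l∈) m∈ i<l (k<m l∈))
                   (top-chain (h∈ h∈hs) (k∈ l∈) m∈ (h<k h∈hs l∈) (k<m l∈)) (<⇒≤ lt))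
        (≤-trans (mono (here refl) (h∈ h∈hs) (k∈ i∈) (g<h h∈hs) (h<k h∈hs i∈))
                 (mono (h∈ h∈hs) (k∈ i∈) (k∈ l∈) (h<k h∈hs i∈) i<l))

    few-bad : ∀ {p ds} → p ∈ pairs → ds ⊆ hs → All (Bad p) ds → length ds ≤ k
    few-bad {i , l} {ds} p∈ ds⊆ bad =
      let i∈ , l∈ = ∈-cartesianProduct⁻ ks ks p∈
      in few-g (top i l) ds (AllPairs-resp-⊆ ds⊆ hs-sorted)
           (All.tabulate λ h∈ds → bad-holds i∈ l∈ (Any-resp-⊆ ds⊆ h∈ds) (All.lookup bad h∈ds))

    no-good : ∀ {h} → h ∈ hs → (∀ {i l} → i ∈ ks → l ∈ ks → ¬ Bad (i , l) h) → ⊥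
    no-good {h} h∈hs good =
      <⇒≱ k<ks (All.lookup few-hs h∈hs (top h l₀) ks (proj₁ km-split) (All.tabulate l₀-holds))
      where
      some = nonempty-∈ {xs = ks} (≤-<-trans z≤n k<ks)

      l₀ : Fin n
      -- The default value is itself taken from `ks`, which keeps `l₀` in `ks`.
      l₀ = argmax (depth h) (proj₁ some) ks

      l₀∈ : l₀ ∈ ks
      l₀∈ = argmax-all (depth h) {P = _∈ ks} (proj₂ some) (All.tabulate id)

      deepest : ∀ {i} → i ∈ ks → depth h i ≤ depth h l₀
      deepest = All.lookup (f[xs]≤f[argmax] (proj₁ some) ks)

      h-at : ∀ {l} → l ∈ ks → B (top l m) h l
      h-at l∈ = top-chain (h∈ h∈hs) (k∈ l∈) m∈ (h<k h∈hs l∈) (k<m l∈)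

      meet : ∀ {i l} → i ∈ ks → l ∈ ks → i Fin.< l → B (top i l) h i × B (top i l) h l
      meet i∈ l∈ i<l =
        top-chain (h∈ h∈hs) (k∈ i∈) (k∈ l∈) (h<k h∈hs i∈) i<l ,
        top-holds (h-at l∈) (top-chain (k∈ i∈) (k∈ l∈) m∈ i<l (k<m l∈))
                  (≮⇒≥ λ lt → good i∈ l∈ (i<l , lt))

      l₀-holds : ∀ {i} → i ∈ ks → B (top h l₀) h i
      l₀-holds {i} i∈ with Fin.<-cmp i l₀
      ... | tri< i<l _ _ = let u , v = meet i∈ l₀∈ i<l in top-holds u v (deepest i∈)
      ... | tri> _ _ l<i = let v , u = meet l₀∈ i∈ l<i in top-holds u v (deepest i∈)
      -- `Tops` does not state that the top of a vertex contains it; this follows by letting the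
      -- vertex share a bag with itself.
      ... | tri≈ _ eq _  = subst (B (top h l₀) h) (sym eq) (top-holds (h-at l₀∈) (h-at l₀∈) ≤-refl)

  no-pool : ∀ cs → Sorted cs → All Few cs → poolSize k (coreSize k) 0 ≤ length cs → ⊥
  no-pool cs sorted few enough with select (coreSize k) [] cs sorted few [] enough
  ... | bs , bs⊆ , eq , mono with split 1 bs eq
  ... | g ∷ [] , rest , refl , _ , eq₁ with split (lowerSize k) rest eq₁
  ... | hs , rest′ , refl , eq-hs , eq₂ with split (suc k) rest′ eq₂
  ... | ks , m ∷ [] , refl , eq-ks , _ =
    no-monotone-core g hs ks m (AllPairs-resp-⊆ bs⊆ sorted) (All.head few-bs)
      (All.++⁻ˡ hs (All.tail few-bs)) mono (≤-reflexive (sym eq-ks))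
      (≤-reflexive (trans (cong (λ p → suc (k * (p * p))) eq-ks) (sym eq-hs)))
    where
    few-bs = All-resp-⊆ bs⊆ few

-- A bag containing one side of the complete bipartite graph at j

module _ {n : ℕ} {X : Set} {B : X → Fin n → Fin n → Set} (L : Tops B) where
  open Tops L

  -- Every (i , j) is adjacent to every (j , l), so the deepest top on one side, if no shallower
  -- than all tops opposite, contains the opposite side. `i₀` and `l₀` make both sides non-empty.
  full-side : ∀ {i₀ j l₀} → i₀ Fin.< j → j Fin.< l₀ →
    (∃ λ x → ∀ {i} → i Fin.< j → B x i j) ⊎ (∃ λ x → ∀ {l} → j Fin.< l → B x j l)
  full-side {i₀} {j} {l₀} i₀<j j<l₀ = case (≤-total (depth i⁺ j) (depth j l⁺))
    where
    lower upper : List (Fin n)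
    lower = filter (Fin._<? j) (allFin n)
    upper = filter (j Fin.<?_) (allFin n)

    i⁺ l⁺ : Fin n
    i⁺ = argmax (λ i → depth i j) i₀ lower
    l⁺ = argmax (λ l → depth j l) l₀ upper

    i⁺<j : i⁺ Fin.< j
    i⁺<j = argmax-all (λ i → depth i j) {P = Fin._< j} i₀<j (all-filter (Fin._<? j) (allFin n))

    j<l⁺ : j Fin.< l⁺
    j<l⁺ = argmax-all (λ l → depth j l) {P = j Fin.<_} j<l₀ (all-filter (j Fin.<?_) (allFin n))

    case : depth i⁺ j ≤ depth j l⁺ ⊎ depth j l⁺ ≤ depth i⁺ j → _
    case (inj₁ le) = inj₁ (top j l⁺ , λ {i} i<j →
      let _ , u , v = adjacent i<j j<l⁺
          i≤i⁺ = All.lookup (f[xs]≤f[argmax] i₀ lower) (∈-filter⁺ (Fin._<? j) (∈-allFin i) i<j)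
      in top-holds u v (≤-trans i≤i⁺ le))
    case (inj₂ le) = inj₂ (top i⁺ j , λ {l} j<l →
      let _ , u , v = adjacent i⁺<j j<l
          l≤l⁺ = All.lookup (f[xs]≤f[argmax] l₀ upper) (∈-filter⁺ (j Fin.<?_) (∈-allFin l) j<l)
      in top-holds v u (≤-trans l≤l⁺ le))

-- Orthogonality

module _ {n : ℕ} (S T : TreeDecomposition (ShiftGraph n)) {k : ℕ} (orth : Orthogonal k S T) where

  -- `line` fixes either the first or the second index; both cases occur below.
  few-in-line : ∀ {x y} (line : Fin n → Fin n × Fin n) → Injective _≡_ _≡_ line → ∀ {cs} → Sorted cs →
    All (λ c → let i , j = line c in Holds S x i j × Holds T y i j) cs → length cs ≤ k
  few-in-line {x} {y} line line-injective {cs} sorted holds = ≮⇒≥ λ k<cs →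
    let c = λ (i : Fin (suc k)) → lookup cs (inject≤ i k<cs)
        at = λ i → All.lookup holds (∈-lookup (inject≤ i k<cs))
    in orth x y
         (λ i → proj₁ (line (c i)) , proj₂ (line (c i)) , proj₁ (proj₁ (at i)))
         (λ eq → inject≤-injective k<cs k<cs _ _ (sorted-lookup-injective sorted
           (line-injective (cong (λ v → fstV v , sndV v) eq))))
         -- The chosen vertex carries the order proof from `S`, so the membership in `T` is
         -- transported to it.
         (λ i → let (p , u) , (q , v) = at i in
           u , subst (λ r → bag T y (_ , _ , r)) (Fin.<-irrelevant q p) v)

FullAt : ∀ {n} → TreeDecomposition (ShiftGraph n) → Fin n → Set
FullAt T j = ∃ λ x → ∀ {l} → j Fin.< l → Holds T x j l

-- At each `j` of `js` a single bag of `T` contains every (j , c), so all such vertices in a bag of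
-- `S` lie in the intersection, and orthogonality gives `Few j` for `S`.
full-impossible : ∀ {n k} (S T : TreeDecomposition (ShiftGraph n)) → Orthogonal k S T → Tops (Holds S) →
  ∀ js → Sorted js → All (FullAt T) js → poolSize k (coreSize k) 0 ≤ length js → ⊥
full-impossible {k = k} S T orth LS js sorted full = no-pool LS k js sorted
  (All.map (λ {j} (y , T-full) x cs cs-sorted in-x →
     few-in-line S T orth (j ,_) (cong proj₂) cs-sorted
       (All.map (λ u → u , T-full (proj₁ u)) in-x)) full)

half-≤ : ∀ N p q → N + N ≡ p + q → N ≤ p ⊎ N ≤ q
half-≤ N p q eq with N ℕ.≤? p | N ℕ.≤? q
... | yes N≤p | _       = inj₁ N≤p
... | no _    | yes N≤q = inj₂ N≤q
... | no N≰p  | no N≰q  = contradiction (sym eq) (ℕ.<⇒≢ (ℕ.+-mono-< (≰⇒> N≰p) (≰⇒> N≰q)))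

theorem39 : ∀ (k : ℕ) → 0 < k → ∃ λ (n : ℕ) →
    ¬ (∃ λ (S : TreeDecomposition (ShiftGraph n)) → ∃ λ (T : TreeDecomposition (ShiftGraph n)) →
    Orthogonal k S T)
theorem39 k _ = n , λ (S , T , orth) → ¬¬-tops S λ LS → ¬¬-tops T λ LT → impossible S T orth LS LT
  where
  N n : ℕ
  N = poolSize k (coreSize k) 0
  -- Three blocks: k + 1 indices below every candidate j, enough to violate orthogonality; 2N
  -- candidates, so that `S` or `T` gets N of them; and a last block that supplies an index above
  -- each j.
  n = suc k + ((N + N) + suc k)

  allFin-sorted : Sorted (allFin n)
  allFin-sorted = AllPairs.tabulate⁺-< id

  impossible : ∀ (S T : TreeDecomposition (ShiftGraph n)) → Orthogonal k S T →
               Tops (Holds S) → Tops (Holds T) → ⊥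
  impossible S T orth LS LT with split (suc k) (allFin n) (length-tabulate id)
  ... | as , rest , eq , as-length , rest-length with split (N + N) rest rest-length
  ... | js , zs , refl , js-length , zs-length =
    let as-sorted , rest-sorted , as<rest = AllPairs-++⁻ as (subst Sorted eq allFin-sorted)
        js-sorted , _ , js<zs = AllPairs-++⁻ js rest-sorted
        a₀ , a₀∈ = nonempty-∈ {xs = as} (subst (0 <_) (sym as-length) (s≤s z≤n))
        z₀ , z₀∈ = nonempty-∈ {xs = zs} (subst (0 <_) (sym zs-length) (s≤s z≤n))
        as<j : ∀ {a j} → a ∈ as → j ∈ js → a Fin.< j
        as<j a∈ j∈ = All.lookup (All.lookup as<rest a∈) (∈-++⁺ˡ j∈)
        side : ∀ {j} → j ∈ js → FullAt T j ⊎ FullAt S j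
        side {j} j∈ = one-full as as-sorted as-length (λ a∈ → as<j a∈ j∈)
          (full-side LS (as<j a₀∈ j∈) (All.lookup (All.lookup js<zs j∈) z₀∈))
          (full-side LT (as<j a₀∈ j∈) (All.lookup (All.lookup js<zs j∈) z₀∈))
    in finish js js-sorted js-length (unmerge js side)
    where
    -- If both decompositions had bags with the whole lower side at `j`, these would share the k + 1
    -- vertices (a , j).
    one-full : ∀ as → Sorted as → length as ≡ suc k → ∀ {j} → (∀ {a} → a ∈ as → a Fin.< j) →
      (∃ λ x → ∀ {i} → i Fin.< j → Holds S x i j) ⊎ FullAt S j →
      (∃ λ x → ∀ {i} → i Fin.< j → Holds T x i j) ⊎ FullAt T j →
      FullAt T j ⊎ FullAt S j
    one-full as _ _ _ _ (inj₂ T-full) = inj₁ T-full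
    one-full as _ _ _ (inj₂ S-full) _ = inj₂ S-full
    one-full as as-sorted as-length {j} as<j (inj₁ (x , S-low)) (inj₁ (y , T-low)) =
      contradiction
        (few-in-line S T orth (_, j) (cong proj₁) as-sorted
          (All.tabulate λ a∈ → S-low (as<j a∈) , T-low (as<j a∈)))
        (<⇒≱ (≤-reflexive (sym as-length)))

    finish : ∀ js → Sorted js → length js ≡ N + N →
      (∃₂ λ ys zs → ys ⊆ js × zs ⊆ js × All (FullAt T) ys × All (FullAt S) zs ×
                    length js ≡ length ys + length zs) → ⊥
    finish js sorted js-length (ys , zs , ys⊆ , zs⊆ , T-full , S-full , eq)
      with half-≤ N (length ys) (length zs) (trans (sym js-length) eq)
    ... | inj₁ N≤ys = full-impossible S T orth LS ys (AllPairs-resp-⊆ ys⊆ sorted) T-full N≤ys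
    ... | inj₂ N≤zs = full-impossible T S orth′ LT zs (AllPairs-resp-⊆ zs⊆ sorted) S-full N≤zs
      where
      orth′ : Orthogonal k T S
      orth′ y x f f-injective holds = orth x y f f-injective (swap ∘ holds)
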